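{- Let $k$ be a positive integer and let $G$ be a $K_{1,k}$-free graph with $n$ vertices. Then $\chi_{CN}(G) = O(\ln k \ln n)$.
   Context: All graphs are simple, finite and undirected. For a vertex $v$, $N_G[v] = \{v\}\cup N_G(v)$ is its closed neighborhood. A conflict-free closed neighborhood (CFCN) coloring of $G$ is an assignment of colors to $V(G)$ such that for every vertex $v$ some color appears exactly once in $N_G[v]$; $\chi_{CN}(G)$ is the minimum number of colors in a CFCN coloring of $G$. $G$ is $K_{1,k}$-free if it contains no induced subgraph isomorphic to the complete bipartite graph $K_{1,k}$. The $O(\cdot)$ is with an absolute constant, as a function of $k$ and $n$.
   Formalization: Stated for k ≥ 2 and n ≥ 2: for k = 1 (edgeless graphs) or n = 1 the bound ln k ln n is 0 while one colour is always needed; ln is replaced by the rounded-up base-2 logarithm, which only changes the absolute constant. -}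

module Defs where

open import Data.Nat using (ℕ)
open import Data.Fin using (Fin)
open import Data.Bool using (Bool; true; false)
open import Data.Product using (Σ; ∃; ∃-syntax; _×_)
open import Data.Sum using (_⊎_)
open import Relation.Nullary using (¬_)
open import Relation.Binary.PropositionalEquality using (_≡_; _≢_)
open import Function.Definitions using (Injective)

record Graph (n : ℕ) : Set where
  field
    adj     : Fin n → Fin n → Bool
    symm    : ∀ u v → adj u v ≡ adj v u
    irrefl  : ∀ v → adj v v ≡ false

open Graph public

Adj : ∀ {n} → Graph n → Fin n → Fin n → Set
Adj G u v = adj G u v ≡ true

InClosedNbhd : ∀ {n} → Graph n → Fin n → Fin n → Set
InClosedNbhd G v u = u ≡ v ⊎ Adj G v u

HasInducedK1 : ∀ {n} → ℕ → Graph n → Set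
HasInducedK1 {n} k G =
  Σ (Fin n) λ v → Σ (Fin k → Fin n) λ f →
    Injective _≡_ _≡_ f
    × (∀ i → Adj G v (f i))
    × (∀ i j → i ≢ j → ¬ Adj G (f i) (f j))

K1k-free : ∀ {n} → ℕ → Graph n → Set
K1k-free k G = ¬ HasInducedK1 k G

IsCFCN : ∀ {n m} → Graph n → (Fin n → Fin m) → Set
IsCFCN {n} {m} G c =
  ∀ v → Σ (Fin m) λ a → Σ (Fin n) λ u →
    InClosedNbhd G v u × c u ≡ a
    × (∀ w → InClosedNbhd G v w → c w ≡ a → w ≡ u)

χCN≤ : ∀ {n} → Graph n → ℕ → Set
χCN≤ {n} G m = Σ (Fin n → Fin m) λ c → IsCFCN G c

{-# OPTIONS --safe #-}
-- Let U be the set of vertices not yet satisfied and A a maximal independent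
-- subset of U. Every v in U has between 1 and k − 1 elements of A in N[v]. For some
-- scale j, a 1/⌈log₂ k⌉ fraction of the v in U have between 2^j and 2^(j+1) of them,
-- and a random subset S of A of density 1/2^(j+2) meets N[v] exactly once with
-- probability at least 1/8 for each of these v. So some S satisfies a
-- 1/(8 ⌈log₂ k⌉) fraction of U with a single fresh colour. Every vertex of S is
-- itself satisfied (N[v] ∩ A = {v} for v in A), so no vertex is ever recoloured,
-- and O(log k log n) rounds exhaust U.
module Submission where

open import Defs
open import Data.Nat using (ℕ; _*_; _≤_)
open import Data.Nat.Logarithm using (⌈log₂_⌉)
open import Data.Product using (Σ; ∃; ∃-syntax; _×_)

open import Data.Nat using
  (zero; suc; pred; _+_; _^_; _<_; _≡ᵇ_; z≤n; s≤s; _≤?_; _<?_; NonZero; ⌈_/2⌉)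
open import Data.Nat.Properties hiding (_≟_; suc-injective)
open import Data.Nat.Induction using (<-wellFounded)
open import Data.Nat.Logarithm.Core using (⌈log2⌉)
open import Data.Nat.Tactic.RingSolver using (solve-∀)
open import Algebra.Properties.Semiring.Sum +-*-semiring
  using (sum; sum-cong-≗; ∑-distrib-+; ∑-comm; *-distribˡ-sum)
open import Data.Bool using (Bool; true; false; T; not; _∧_; if_then_else_)
import Data.Bool.Properties as Bool
open import Data.Fin using (Fin; zero; suc; toℕ; fromℕ; fromℕ<; inject₁)
open import Data.Fin.Properties using (_≟_; suc-injective; toℕ-fromℕ; toℕ-inject₁; fromℕ<-injective)
open import Data.List using (List; []; _∷_; filter; allFin)
open import Data.List.Membership.Propositional using (_∈_; find; lose)
open import Data.List.Membership.Propositional.Properties using (∈-filter⁺; ∈-filter⁻; ∈-allFin)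
open import Data.List.Relation.Unary.Any using (here; there; any?)
open import Data.Product using (_,_; proj₁; proj₂)
open import Data.Sum using (_⊎_; inj₁; inj₂)
import Data.Vec.Functional as V
open import Function using (_∘_)
open import Function.Definitions using (Injective)
open import Induction.WellFounded using (Acc; acc)
open import Relation.Binary.PropositionalEquality
  using (_≡_; _≢_; refl; sym; trans; cong; cong₂; subst)
open import Relation.Nullary using (¬_; Dec; yes; no; does; contradiction)
open import Relation.Nullary.Decidable using (_×-dec_; _⊎-dec_; dec-true; dec-false)

-- Logarithms, finite sums and counting.

does⇒ : ∀ {P : Set} (P? : Dec P) → does P? ≡ true → P
does⇒ (yes p) _ = p

∧-true : ∀ {a b} → a ∧ b ≡ true → a ≡ true × b ≡ true
∧-true {true} eq = refl , eq

n≤2^⌈log₂n⌉ : ∀ n → n ≤ 2 ^ ⌈log₂ n ⌉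
n≤2^⌈log₂n⌉ n = go n (<-wellFounded n)
  where
  double : ∀ n → n ≤ 2 * ⌈ n /2⌉
  double zero = z≤n
  double (suc zero) = s≤s z≤n
  double (suc (suc n)) = begin
    2 + n             ≤⟨ +-monoʳ-≤ 2 (double n) ⟩
    2 + 2 * ⌈ n /2⌉   ≡⟨ *-suc 2 ⌈ n /2⌉ ⟨
    2 * suc ⌈ n /2⌉   ∎
    where open ≤-Reasoning
  -- `⌈log₂_⌉` is defined by well-founded recursion; keeping the accessibility proof arbitrary lets
  -- the induction follow that recursion.
  go : ∀ n (rs : Acc _<_ n) → n ≤ 2 ^ ⌈log2⌉ n rs
  go zero rs = z≤n
  go (suc zero) rs = s≤s z≤n
  go (suc (suc n)) (acc rs) =
    ≤-trans (double (2 + n)) (*-monoʳ-≤ 2 (go (suc ⌈ n /2⌉) _))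

sum-mono-≤ : ∀ {n} {f g : Fin n → ℕ} → (∀ i → f i ≤ g i) → sum f ≤ sum g
sum-mono-≤ {zero}  f≤g = z≤n
sum-mono-≤ {suc n} f≤g = +-mono-≤ (f≤g zero) (sum-mono-≤ (f≤g ∘ suc))

term≤sum : ∀ {n} (f : Fin n → ℕ) i → f i ≤ sum f
term≤sum f zero    = m≤m+n _ _
term≤sum f (suc i) = ≤-trans (term≤sum (f ∘ suc) i) (m≤n+m _ _)

sum≤n*max : ∀ n (f : Fin (suc n) → ℕ) → ∃[ j ] sum f ≤ suc n * f j
sum≤n*max zero f = zero , ≤-refl
sum≤n*max (suc n) f with sum≤n*max n (f ∘ suc)
... | j , le with ≤-total (f zero) (f (suc j))
...   | inj₁ p = suc j , +-mono-≤ p le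
...   | inj₂ p = zero , +-monoʳ-≤ (f zero) (≤-trans le (*-monoʳ-≤ (suc n) p))

ind : Bool → ℕ
ind true  = 1
ind false = 0

ind-split : ∀ a b → ind a ≡ ind (a ∧ not b) + ind (a ∧ b)
ind-split true  true  = refl
ind-split true  false = refl
ind-split false _     = refl

count : ∀ {n} → (Fin n → Bool) → ℕ
count p = sum (ind ∘ p)

count-split : ∀ {n} (p q : Fin n → Bool) →
  count p ≡ count (λ i → p i ∧ not (q i)) + count (λ i → p i ∧ q i)
count-split p q =
  trans (sum-cong-≗ (λ i → ind-split (p i) (q i)))
    (∑-distrib-+ (λ i → ind (p i ∧ not (q i))) (λ i → ind (p i ∧ q i)))

count≤n : ∀ {n} (p : Fin n → Bool) → count p ≤ n
count≤n {zero}  p = z≤n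
count≤n {suc n} p = +-mono-≤ (ind≤1 (p zero)) (count≤n (p ∘ suc))
  where
  ind≤1 : ∀ b → ind b ≤ 1
  ind≤1 true  = s≤s z≤n
  ind≤1 false = z≤n

count-positive : ∀ {n} (p : Fin n → Bool) i → p i ≡ true → 1 ≤ count p
count-positive p i eq = subst (λ b → ind b ≤ count p) eq (term≤sum (ind ∘ p) i)

-- Turns a lower bound on a count into an injection, the form in which the leaves of a star have to
-- be exhibited.
choose : ∀ {n} k (p : Fin n → Bool) → k ≤ count p →
  Σ (Fin k → Fin n) λ f → Injective _≡_ _≡_ f × (∀ i → p (f i) ≡ true)
choose {zero} zero p _ = (λ ()) , (λ { {()} }) , λ ()
choose {suc n} zero p _ = (λ ()) , (λ { {()} }) , λ ()
choose {suc n} (suc k) p le with p zero in eq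
choose {suc n} (suc k) p (s≤s le) | true with choose k (p ∘ suc) le
... | f , inj , pf = g , g-inj , pg
  where
  g : Fin (suc k) → Fin (suc n)
  g zero    = zero
  g (suc i) = suc (f i)
  g-inj : Injective _≡_ _≡_ g
  g-inj {zero}  {zero}  _ = refl
  g-inj {suc i} {suc j} e = cong suc (inj (suc-injective e))
  pg : ∀ i → p (g i) ≡ true
  pg zero    = eq
  pg (suc i) = pf i
choose {suc n} (suc k) p le | false with choose (suc k) (p ∘ suc) le
... | f , inj , pf = suc ∘ f , inj ∘ suc-injective , pf

count≡1⇒∃! : ∀ {n} (p : Fin n → Bool) → count p ≡ 1 →
  ∃[ i ] (p i ≡ true × (∀ j → p j ≡ true → j ≡ i))
count≡1⇒∃! {suc n} p c with p zero in eq
... | true = zero , eq , λ where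
    zero    _  → refl
    (suc j) pj → contradiction (count-positive (p ∘ suc) j pj)
                   (subst (λ x → ¬ 1 ≤ x) (sym (cong pred c)) λ ())
... | false with count≡1⇒∃! (p ∘ suc) c
...   | i , pi , uniq = suc i , pi , λ where
    zero    p0 → contradiction (trans (sym eq) p0) λ ()
    (suc j) pj → cong suc (uniq j pj)

-- Were the count at least 2, `choose` would produce two distinct witnesses, both equal to `i`.
∃!⇒count≡1 : ∀ {n} (p : Fin n → Bool) i → p i ≡ true →
  (∀ j → p j ≡ true → j ≡ i) → count p ≡ 1
∃!⇒count≡1 p i pi uniq with 2 ≤? count p
... | no c≱2 = ≤-antisym (≤-pred (≰⇒> c≱2)) (count-positive p i pi)
... | yes c≥2 with choose 2 p c≥2
...   | f , inj , pf =
  contradiction (inj (trans (uniq _ (pf zero)) (sym (uniq _ (pf (suc zero)))))) λ ()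

-- Weighted expectation over random subsets.

-- E is (w + 1)ⁿ times the expectation when each i lies in the random set with
-- probability 1 / (w + 1), independently.
module _ (w : ℕ) where

  E : ∀ n → ((Fin n → Bool) → ℕ) → ℕ
  E zero    F = F V.[]
  E (suc n) F = w * E n (λ S → F (false V.∷ S)) + E n (λ S → F (true V.∷ S))

  E-zero : ∀ n → E n (λ _ → 0) ≡ 0
  E-zero zero    = refl
  E-zero (suc n) rewrite E-zero n = trans (+-identityʳ _) (*-zeroʳ w)

  E-sum : ∀ n {m} (F : Fin m → (Fin n → Bool) → ℕ) →
    E n (λ S → sum (λ v → F v S)) ≡ sum (λ v → E n (F v))
  E-sum zero    F = refl
  E-sum (suc n) F = trans
    (cong₂ _+_
      (trans (cong (w *_) (E-sum n F₀)) (*-distribˡ-sum w (λ v → E n (F₀ v))))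
      (E-sum n F₁))
    (sym (∑-distrib-+ (λ v → w * E n (F₀ v)) (λ v → E n (F₁ v))))
    where
    F₀ F₁ : Fin _ → (Fin n → Bool) → ℕ
    F₀ v S = F v (false V.∷ S)
    F₁ v S = F v (true V.∷ S)

  average≤ : ∀ P c {a b} → a ≤ P * c → b ≤ P * c → w * a + b ≤ suc w * P * c
  average≤ P c {a} {b} a≤ b≤ = begin
    w * a + b              ≤⟨ +-mono-≤ (*-monoʳ-≤ w a≤) b≤ ⟩
    w * (P * c) + P * c    ≡⟨ +-comm (w * (P * c)) _ ⟩
    suc w * (P * c)        ≡⟨ *-assoc (suc w) P c ⟨
    suc w * P * c          ∎
    where open ≤-Reasoning

  -- First moment method: `suc w ^ n` is the total weight of all subsets, and at each coordinate a
  -- weighted average of two branches is at most the better branch.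
  E≤max : ∀ n (F : (Fin n → Bool) → ℕ) → ∃[ S ] E n F ≤ suc w ^ n * F S
  E≤max zero    F = V.[] , m≤m+n (F V.[]) 0
  E≤max (suc n) F with E≤max n (λ S → F (false V.∷ S)) | E≤max n (λ S → F (true V.∷ S))
  ... | S₀ , le₀ | S₁ , le₁ with ≤-total (F (false V.∷ S₀)) (F (true V.∷ S₁))
  ...   | inj₁ p = true V.∷ S₁ , average≤ (suc w ^ n) _ (≤-trans le₀ (*-monoʳ-≤ (suc w ^ n) p)) le₁
  ...   | inj₂ p = false V.∷ S₀ , average≤ (suc w ^ n) _ le₀ (≤-trans le₁ (*-monoʳ-≤ (suc w ^ n) p))

-- The chance that a random set meets a given set exactly once.

hits : ∀ {n} → (Fin n → Bool) → (Fin n → Bool) → ℕ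
hits e S = count (λ i → e i ∧ S i)

module _ (w : ℕ) where

  -- With s = `count e` and d = w + 1, these weights are w^s d^(n-s) and s w^(s-1) d^(n-s). The
  -- closed forms are avoided in favour of two relations proved coordinate by coordinate.
  missed isolated : ∀ {n} → (Fin n → Bool) → ℕ
  missed   {n} e = E w n (λ S → ind (hits e S ≡ᵇ 0))
  isolated {n} e = E w n (λ S → ind (hits e S ≡ᵇ 1))

  -- Dropping the single hit from a set multiplies its weight by `w` and leaves a set that misses
  -- `e`; each such set arises from `count e` choices of the hit.
  isolated-missed : ∀ {n} (e : Fin n → Bool) → w * isolated e ≡ count e * missed e
  isolated-missed {zero}  e = *-zeroʳ w
  isolated-missed {suc n} e = step (e zero) (e ∘ suc) (isolated-missed (e ∘ suc))
    where
    step : ∀ b (e′ : Fin n → Bool) → w * isolated e′ ≡ count e′ * missed e′ →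
      w * isolated (b V.∷ e′) ≡ count (b V.∷ e′) * missed (b V.∷ e′)
    step false e′ ih = trans (lem w (isolated e′))
      (trans (cong (λ x → w * x + x) ih) (lem′ w (count e′) (missed e′)))
      where
      lem : ∀ w o → w * (w * o + o) ≡ w * (w * o) + w * o
      lem = solve-∀
      lem′ : ∀ w s z → w * (s * z) + s * z ≡ s * (w * z + z)
      lem′ = solve-∀
    -- Picking an element of `e` rules out a miss, so that branch of `missed` is the expectation of
    -- 0.
    step true e′ ih rewrite E-zero w n =
      trans (cong (λ x → w * (x + missed e′)) ih) (lem w (count e′) (missed e′))
      where
      lem : ∀ w s z → w * (s * z + z) ≡ suc s * (w * z + 0)
      lem = solve-∀

  -- Bernoulli's inequality (1 - 1/d)^s ≥ 1 - s/d for d = `suc w`, multiplied by d^(n+1) and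
  -- arranged without subtraction.
  bernoulli : ∀ {n} (e : Fin n → Bool) →
    suc w * suc w ^ n ≤ suc w * missed e + count e * suc w ^ n
  bernoulli {zero}  e = ≤-reflexive (sym (+-identityʳ _))
  bernoulli {suc n} e = step (e zero) (e ∘ suc) (bernoulli (e ∘ suc))
    where
    open ≤-Reasoning
    d = suc w
    step : ∀ b (e′ : Fin n → Bool) →
      d * d ^ n ≤ d * missed e′ + count e′ * d ^ n →
      d * d ^ suc n ≤ d * missed (b V.∷ e′) + count (b V.∷ e′) * d ^ suc n
    step false e′ ih = begin
      d * (d * d ^ n)                              ≤⟨ *-monoʳ-≤ d ih ⟩
      d * (d * missed e′ + count e′ * d ^ n)       ≡⟨ lem w (missed e′) (count e′) (d ^ n) ⟩
      d * (w * missed e′ + missed e′) + count e′ * (d * d ^ n) ∎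
      where
      lem : ∀ w z s p → suc w * (suc w * z + s * p)
                      ≡ suc w * (w * z + z) + s * (suc w * p)
      lem = solve-∀
    step true e′ ih rewrite E-zero w n = begin
      d * (d * d ^ n)                                        ≡⟨⟩
      d * d ^ n + w * (d * d ^ n)                            ≤⟨ +-monoʳ-≤ (d * d ^ n) (*-monoʳ-≤ w ih) ⟩
      -- The added term is the s/d² in (1 - 1/d)(1 - s/d) = 1 - (s+1)/d + s/d².
      d * d ^ n + w * (d * missed e′ + count e′ * d ^ n)     ≤⟨ m≤m+n _ (count e′ * d ^ n) ⟩
      d * d ^ n + w * (d * missed e′ + count e′ * d ^ n) + count e′ * d ^ n
        ≡⟨ lem w (missed e′) (count e′) (d ^ n) ⟩
      d * (w * missed e′ + 0) + suc (count e′) * (d * d ^ n) ∎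
      where
      lem : ∀ w z s p → suc w * p + w * (suc w * z + s * p) + s * p
                      ≡ suc w * (w * z + 0) + suc s * (suc w * p)
      lem = solve-∀

  -- Since s ≤ d/2, `bernoulli` makes a miss have probability at least 1/2; by `isolated-missed`, a
  -- single hit is at least s/d ≥ 1/4 times as likely, hence the 1/8.
  isolated-bound : ∀ {n} (e : Fin n → Bool) →
    2 * count e ≤ suc w → suc w ≤ 4 * count e → suc w ^ n ≤ 8 * isolated e
  isolated-bound {n} e 2s≤d d≤4s = *-cancelˡ-≤ d (begin
    d * p            ≤⟨ *-monoʳ-≤ d p≤2Z ⟩
    d * (2 * Z)      ≤⟨ *-monoˡ-≤ (2 * Z) d≤4s ⟩
    4 * s * (2 * Z)  ≡⟨ lem₁ s Z ⟩
    8 * (s * Z)      ≡⟨ cong (8 *_) (isolated-missed e) ⟨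
    8 * (w * O)      ≤⟨ *-monoʳ-≤ 8 (*-monoˡ-≤ O (n≤1+n w)) ⟩
    8 * (d * O)      ≡⟨ lem₂ d O ⟩
    d * (8 * O)      ∎)
    where
    open ≤-Reasoning
    d = suc w
    p = d ^ n
    s = count e
    Z = missed e
    O = isolated e
    lem₁ : ∀ s z → 4 * s * (2 * z) ≡ 8 * (s * z)
    lem₁ = solve-∀
    lem₂ : ∀ d o → 8 * (d * o) ≡ d * (8 * o)
    lem₂ = solve-∀
    lem₃ : ∀ d p → d * p + d * p ≡ 2 * (d * p)
    lem₃ = solve-∀
    lem₄ : ∀ d z s p → 2 * (d * z + s * p) ≡ d * (2 * z) + 2 * s * p
    lem₄ = solve-∀
    p≤2Z : p ≤ 2 * Z
    p≤2Z = *-cancelˡ-≤ d (+-cancelʳ-≤ (d * p) (d * p) (d * (2 * Z)) (begin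
      d * p + d * p            ≡⟨ lem₃ d p ⟩
      2 * (d * p)              ≤⟨ *-monoʳ-≤ 2 (bernoulli e) ⟩
      2 * (d * Z + s * p)      ≡⟨ lem₄ d Z s p ⟩
      d * (2 * Z) + 2 * s * p  ≤⟨ +-monoʳ-≤ (d * (2 * Z)) (*-monoˡ-≤ p 2s≤d) ⟩
      d * (2 * Z) + d * p      ∎))

-- Dyadic scales and the choice of the random set.

InScale : ℕ → ℕ → Set
InScale j s = 2 ^ j ≤ s × s < 2 ^ suc j

inScale? : ∀ j s → Dec (InScale j s)
inScale? j s = 2 ^ j ≤? s ×-dec s <? 2 ^ suc j

scale : ∀ L {s} → 1 ≤ s → s < 2 ^ L → ∃[ j ] InScale (toℕ {L} j) s
scale zero    1≤s s<1 = contradiction (≤-trans s<1 1≤s) (<-irrefl refl)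
scale (suc L) {s} 1≤s s<2^ with 2 ^ L ≤? s
... | yes p = fromℕ L , subst (λ j → InScale j s) (sym (toℕ-fromℕ L)) (p , s<2^)
... | no ¬p with scale L 1≤s (≰⇒> ¬p)
...   | j , q = inject₁ j , subst (λ j → InScale j s) (sym (toℕ-inject₁ j)) q

-- For s at scale j, 2s ≤ 4 * 2^j ≤ 4s, so density 1/(4 * 2^j) meets both hypotheses of
-- `isolated-bound`. Linearity and `E≤max` then give one `S` at least as good as the average.
isolate-scale : ∀ {m n} j w → suc w ≡ 4 * 2 ^ j → (U : Fin m → Bool) (e : Fin m → Fin n → Bool) →
  ∃[ S ] count (λ v → U v ∧ does (inScale? j (count (e v))))
       ≤ 8 * count (λ v → U v ∧ (hits (e v) S ≡ᵇ 1))
isolate-scale {m} {n} j w 1+w U e = S , *-cancelˡ-≤ P {{m^n≢0 (suc w) n}} (begin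
  P * sum (λ v → ind (V v))          ≡⟨ *-distribˡ-sum P (λ v → ind (V v)) ⟩
  sum (λ v → P * ind (V v))          ≤⟨ sum-mono-≤ (λ v → bound v (U v) (inScale? j (count (e v)))) ⟩
  sum (λ v → 8 * E w n (F v))        ≡⟨ *-distribˡ-sum 8 (λ v → E w n (F v)) ⟨
  8 * sum (λ v → E w n (F v))        ≡⟨ cong (8 *_) (E-sum w n F) ⟨
  8 * E w n (λ S → sum (λ v → F v S)) ≤⟨ *-monoʳ-≤ 8 (proj₂ best) ⟩
  8 * (P * X)                        ≡⟨ swap P X ⟩
  P * (8 * X)                        ∎)
  where
  open ≤-Reasoning
  P = suc w ^ n
  V : Fin m → Bool
  V v = U v ∧ does (inScale? j (count (e v)))
  F : Fin m → (Fin n → Bool) → ℕ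
  F v S = ind (U v ∧ (hits (e v) S ≡ᵇ 1))
  best : ∃[ S ] E w n (λ S → sum (λ v → F v S)) ≤ P * sum (λ v → F v S)
  best = E≤max w n (λ S → sum (λ v → F v S))
  S = proj₁ best
  X = sum (λ v → F v S)
  swap : ∀ p x → 8 * (p * x) ≡ p * (8 * x)
  swap = solve-∀
  lem : ∀ x → 2 * (2 * x) ≡ 4 * x
  lem = solve-∀
  bound : ∀ v u (d : Dec (InScale j (count (e v)))) →
    P * ind (u ∧ does d) ≤ 8 * E w n (λ S → ind (u ∧ (hits (e v) S ≡ᵇ 1)))
  bound v false _      = ≤-trans (≤-reflexive (*-zeroʳ P)) z≤n
  bound v true  (no _) = ≤-trans (≤-reflexive (*-zeroʳ P)) z≤n
  bound v true  (yes (lo , hi)) = ≤-trans (≤-reflexive (*-identityʳ P)) (isolated-bound w (e v)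
    (≤-trans (*-monoʳ-≤ 2 (<⇒≤ hi)) (≤-reflexive (trans (lem (2 ^ j)) (sym 1+w))))
    (≤-trans (≤-reflexive 1+w) (*-monoʳ-≤ 4 lo)))

-- Every vertex of `U` lies at one of the `suc L` scales, so the scale counts add up to at least
-- `count U` and the largest is at least a `1/suc L` share of it.
isolate : ∀ {m n} L (U : Fin m → Bool) (e : Fin m → Fin n → Bool) →
  (∀ v → U v ≡ true → 1 ≤ count (e v) × count (e v) < 2 ^ suc L) →
  ∃[ S ] count U ≤ 8 * suc L * count (λ v → U v ∧ (hits (e v) S ≡ᵇ 1))
isolate {m} L U e small = S , (begin
  count U                                   ≤⟨ sum-mono-≤ (λ v → cover v (U v) (small v)) ⟩
  sum (λ v → sum (λ j → ind (inU j v)))     ≡⟨ ∑-comm (λ v j → ind (inU j v)) ⟩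
  sum (λ j → count (inU j))                 ≤⟨ proj₂ best ⟩
  suc L * count (inU j)                     ≤⟨ *-monoʳ-≤ (suc L) (proj₂ isolating) ⟩
  suc L * (8 * X)                           ≡⟨ assoc (suc L) X ⟩
  8 * suc L * X                             ∎)
  where
  open ≤-Reasoning
  inU : Fin (suc L) → Fin m → Bool
  inU j v = U v ∧ does (inScale? (toℕ j) (count (e v)))
  best : ∃[ j ] sum (λ j → count (inU j)) ≤ suc L * count (inU j)
  best = sum≤n*max L (λ j → count (inU j))
  j = proj₁ best
  isolating : ∃[ S ] count (inU j) ≤ 8 * count (λ v → U v ∧ (hits (e v) S ≡ᵇ 1))
  isolating = isolate-scale (toℕ j) (pred (4 * 2 ^ toℕ j))
    (suc-pred (4 * 2 ^ toℕ j) {{m*n≢0 4 (2 ^ toℕ j) {{_}} {{m^n≢0 2 (toℕ j)}}}}) U e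
  S = proj₁ isolating
  X = count (λ v → U v ∧ (hits (e v) S ≡ᵇ 1))
  assoc : ∀ l x → l * (8 * x) ≡ 8 * l * x
  assoc = solve-∀
  cover : ∀ v u → (u ≡ true → 1 ≤ count (e v) × count (e v) < 2 ^ suc L) →
    ind u ≤ sum {suc L} (λ j → ind (u ∧ does (inScale? (toℕ j) (count (e v)))))
  cover v false _  = z≤n
  cover v true  sm with scale (suc L) (proj₁ (sm refl)) (proj₂ (sm refl))
  ... | i , q = count-positive {suc L} (λ j → does (inScale? (toℕ j) (count (e v)))) i
                  (dec-true (inScale? (toℕ i) (count (e v))) q)

-- Maximal independent sets and partial colourings.

module _ {n} (G : Graph n) where

  inClosedNbhd? : ∀ v u → Dec (InClosedNbhd G v u)
  inClosedNbhd? v u = u ≟ v ⊎-dec (adj G v u Bool.≟ true)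

  Adj-sym : ∀ {u v} → Adj G u v → Adj G v u
  Adj-sym {u} {v} a = trans (symm G v u) a

  Adj-irrefl : ∀ {v} → ¬ Adj G v v
  Adj-irrefl {v} a = contradiction (trans (sym (irrefl G v)) a) λ ()

  -- Maximality is stored as domination, which is what later makes each set `e v` nonempty.
  record MaximalIndependent (xs : List (Fin n)) : Set where
    field
      elements    : List (Fin n)
      ⊆xs         : ∀ {v} → v ∈ elements → v ∈ xs
      independent : ∀ {u v} → u ∈ elements → v ∈ elements → ¬ Adj G u v
      dominating  : ∀ {v} → v ∈ xs → ∃[ u ] (u ∈ elements × InClosedNbhd G v u)

  -- Greedy: `x` joins only if the set built from the tail does not already meet its closed
  -- neighbourhood.
  maximalIndependent : ∀ xs → MaximalIndependent xs
  maximalIndependent [] = record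
    { elements = [] ; ⊆xs = λ () ; independent = λ () ; dominating = λ () }
  maximalIndependent (x ∷ xs) with maximalIndependent xs
  ... | record { elements = A ; ⊆xs = A⊆ ; independent = indep ; dominating = dom }
    with any? (inClosedNbhd? x) A
  ... | yes hit = record
    { elements    = A
    ; ⊆xs         = there ∘ A⊆
    ; independent = indep
    ; dominating  = λ { (here refl) → find hit ; (there v∈) → dom v∈ }
    }
  ... | no ¬hit = record
    { elements    = x ∷ A
    ; ⊆xs         = λ { (here eq) → here eq ; (there v∈) → there (A⊆ v∈) }
    ; independent = λ where
        (here refl) (here refl) a → Adj-irrefl a
        (here refl) (there v∈)  a → ¬hit (lose v∈ (inj₂ a))
        (there u∈)  (here refl) a → ¬hit (lose u∈ (inj₂ (Adj-sym a)))
        (there u∈)  (there v∈)  a → indep u∈ v∈ a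
    ; dominating  = λ where
        (here refl) → x , here refl , inj₁ refl
        (there v∈)  → let u , u∈ , c = dom v∈ in u , there u∈ , c
    }

  -- Colour 0 stands for "uncoloured".
  record Solution (U : Fin n → Bool) (m : ℕ) : Set where
    field
      colour  : Fin n → ℕ
      bounded : ∀ v → colour v ≤ m
      support : ∀ v → U v ≡ false → colour v ≡ 0
      unique  : ∀ v → U v ≡ true → ∃[ u ]
        (InClosedNbhd G v u × colour u ≢ 0 ×
         (∀ w → InClosedNbhd G v w → colour w ≡ colour u → w ≡ u))

  -- The inequality says |U′| ≤ (1 - 1/M)|U| without division or subtraction: one extra colour
  -- removes a 1/M fraction.
  Reduction : ℕ → (Fin n → Bool) → Set
  Reduction M U = ∃[ U′ ] (M * count U′ + count U ≤ M * count U
                           × (∀ m → Solution U′ m → Solution U (suc m)))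

  open import Data.List.Membership.DecPropositional (_≟_ {n}) using (_∈?_)

  -- One round: a single fresh colour on an independent set.

  module _ {k} (2≤k : 2 ≤ k) (free : K1k-free k G) L (k≤2^ : k ≤ 2 ^ suc L) where

    private
      M : ℕ
      M = 8 * suc L

    reduce : ∀ U → Reduction M U
    reduce U = U′ , shrink , extend
      where
      U-list : List (Fin n)
      U-list = filter (λ v → U v Bool.≟ true) (allFin n)

      open MaximalIndependent (maximalIndependent U-list) renaming (elements to A)

      A⊆U : ∀ {v} → v ∈ A → U v ≡ true
      A⊆U v∈ = proj₂ (∈-filter⁻ (λ v → U v Bool.≟ true) {xs = allFin n} (⊆xs v∈))

      e? : ∀ v u → Dec (InClosedNbhd G v u × u ∈ A)
      e? v u = inClosedNbhd? v u ×-dec (u ∈? A)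

      e : Fin n → Fin n → Bool
      e v u = does (e? v u)

      nonempty : ∀ v → U v ≡ true → 1 ≤ count (e v)
      nonempty v Uv with dominating (∈-filter⁺ (λ v → U v Bool.≟ true) (∈-allFin v) Uv)
      ... | u , u∈ , c = count-positive (e v) u (dec-true (e? v u) (c , u∈))

      another : ∀ {k} → 2 ≤ k → (i : Fin k) → ∃[ j ] i ≢ j
      another (s≤s (s≤s _)) zero    = suc zero , λ ()
      another (s≤s (s≤s _)) (suc i) = zero , λ ()

      -- With `k` elements of the independent set `A` in its closed neighbourhood, `v` would be the
      -- centre of an induced star.
      few : ∀ v → count (e v) < k
      few v = ≰⇒> λ k≤ → star (choose k (e v) k≤)
        where
        star : ¬ (Σ (Fin k → Fin n) λ f → Injective _≡_ _≡_ f × (∀ i → e v (f i) ≡ true))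
        star (f , inj , ef) = free (v , f , inj , adjacent ,
            λ i j _ → independent (inA i) (inA j))
          where
          nbr : ∀ i → InClosedNbhd G v (f i)
          nbr i = proj₁ (does⇒ (e? v (f i)) (ef i))
          inA : ∀ i → f i ∈ A
          inA i = proj₂ (does⇒ (e? v (f i)) (ef i))
          adjacent : ∀ i → Adj G v (f i)
          adjacent i with nbr i
          ... | inj₂ a = a
          -- If `v` were itself a leaf, then `v` is in `A`; a second leaf is either `v` again,
          -- against injectivity, or a neighbour of `v` in `A`, against independence.
          ... | inj₁ fi≡v with another 2≤k i
          ...   | j , i≢j with nbr j
          ...     | inj₁ fj≡v = contradiction (inj (trans fi≡v (sym fj≡v))) i≢j
          ...     | inj₂ a = contradiction a (independent (subst (_∈ A) fi≡v (inA i)) (inA j))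

      isolating : ∃[ S ] count U ≤ M * count (λ v → U v ∧ (hits (e v) S ≡ᵇ 1))
      isolating = isolate L U e (λ v Uv → nonempty v Uv , ≤-trans (few v) k≤2^)

      S : Fin n → Bool
      S = proj₁ isolating

      satisfied : Fin n → Bool
      satisfied v = hits (e v) S ≡ᵇ 1

      U′ : Fin n → Bool
      U′ v = U v ∧ not (satisfied v)

      shrink : M * count U′ + count U ≤ M * count U
      shrink = begin
        M * count U′ + count U                                    ≤⟨ +-monoʳ-≤ (M * count U′) (proj₂ isolating) ⟩
        M * count U′ + M * count (λ v → U v ∧ satisfied v)        ≡⟨ *-distribˡ-+ M (count U′) _ ⟨
        M * (count U′ + count (λ v → U v ∧ satisfied v))          ≡⟨ cong (M *_) (count-split U satisfied) ⟨
        M * count U                                               ∎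
        where open ≤-Reasoning

      chosen? : ∀ u → Dec (u ∈ A × S u ≡ true)
      chosen? u = u ∈? A ×-dec (S u Bool.≟ true)

      satisfied⇒∃! : ∀ v → satisfied v ≡ true → ∃[ u ]
        ((InClosedNbhd G v u × u ∈ A × S u ≡ true) ×
         (∀ w → InClosedNbhd G v w → w ∈ A × S w ≡ true → w ≡ u))
      satisfied⇒∃! v sat with count≡1⇒∃! (λ i → e v i ∧ S i)
                               (≡ᵇ⇒≡ _ 1 (subst T (sym sat) _))
      ... | u , p , uniq with ∧-true p
      ...   | eu , Su with does⇒ (e? v u) eu
      ...     | c , u∈ = u , (c , u∈ , Su) ,
        λ w cw (w∈ , Sw) → uniq w (cong₂ _∧_ (dec-true (e? v w) (cw , w∈)) Sw)

      -- A vertex of `A` has no neighbour in `A`, so it is its own only hit.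
      chosen⇒satisfied : ∀ {u} → u ∈ A × S u ≡ true → satisfied u ≡ true
      chosen⇒satisfied {u} (u∈ , Su) = cong (_≡ᵇ 1)
        (∃!⇒count≡1 (λ i → e u i ∧ S i) u (cong₂ _∧_ (dec-true (e? u u) (inj₁ refl , u∈)) Su)
          λ w p → only w (does⇒ (e? u w) (proj₁ (∧-true p))))
        where
        only : ∀ w → InClosedNbhd G u w × w ∈ A → w ≡ u
        only w (inj₁ eq , _)  = eq
        only w (inj₂ a , w∈) = contradiction a (independent u∈ w∈)

      -- By `support`, a solution for `U′` therefore leaves the chosen vertices uncoloured, free to
      -- take the fresh colour.
      chosen∉U′ : ∀ {u} → u ∈ A × S u ≡ true → U′ u ≡ false
      chosen∉U′ ch rewrite A⊆U (proj₁ ch) | chosen⇒satisfied ch = refl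

      -- The colour `suc m` goes exactly to the chosen vertices; it lies above all old colours and
      -- overwrites only 0.
      extend : ∀ m → Solution U′ m → Solution U (suc m)
      extend m sol = record
        { colour = col ; bounded = bnd ; support = sup ; unique = unq }
        where
        open Solution sol
        col : Fin n → ℕ
        col u = if does (chosen? u) then suc m else colour u

        fresh : ∀ {u} → u ∈ A × S u ≡ true → col u ≡ suc m
        fresh {u} ch = cong (if_then suc m else colour u) (dec-true (chosen? u) ch)

        old : ∀ {u} → ¬ (u ∈ A × S u ≡ true) → col u ≡ colour u
        old {u} ¬ch = cong (if_then suc m else colour u) (dec-false (chosen? u) ¬ch)

        bnd : ∀ v → col v ≤ suc m
        bnd v with chosen? v
        ... | yes ch = ≤-reflexive (fresh ch)
        ... | no ¬ch = ≤-trans (≤-reflexive (old ¬ch)) (m≤n⇒m≤1+n (bounded v))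

        sup : ∀ v → U v ≡ false → col v ≡ 0
        sup v Uv with chosen? v
        ... | yes (v∈ , _) = contradiction (trans (sym Uv) (A⊆U v∈)) λ ()
        ... | no ¬ch = trans (old ¬ch) (support v (cong (_∧ not (satisfied v)) Uv))

        unq : ∀ v → U v ≡ true → ∃[ u ]
          (InClosedNbhd G v u × col u ≢ 0 ×
           (∀ w → InClosedNbhd G v w → col w ≡ col u → w ≡ u))
        unq v Uv with satisfied v Bool.≟ true
        ... | yes sat with satisfied⇒∃! v sat
        ...   | u , (c , ch) , uniq = u , c , (λ z → 0≢1+n (trans (sym z) (fresh ch))) , uniq′
          where
          uniq′ : ∀ w → InClosedNbhd G v w → col w ≡ col u → w ≡ u
          uniq′ w cw eq with chosen? w
          ... | yes chw = uniq w cw chw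
          -- An unchosen `w` keeps a colour at most `m`, which cannot be `suc m`.
          ... | no ¬chw = contradiction
            (≤-trans (≤-reflexive (trans (sym (fresh ch)) (trans (sym eq) (old ¬chw))))
                     (bounded w))
            (<-irrefl refl)
        unq v Uv | no ¬sat with unique v (cong₂ _∧_ Uv (cong not (Bool.¬-not ¬sat)))
        ...   | u , c , u≢0 , uniq = u , c , (λ z → u≢0 (trans (sym old-u) z)) , uniq′
          where
          old-u : col u ≡ colour u
          -- The old colour of `u` is nonzero, whereas chosen vertices had colour 0; so `u` is not
          -- recoloured.
          old-u = old λ ch → u≢0 (support u (chosen∉U′ ch))
          uniq′ : ∀ w → InClosedNbhd G v w → col w ≡ col u → w ≡ u
          uniq′ w cw eq with chosen? w
          ... | yes chw = contradiction
            (≤-trans (≤-reflexive (trans (sym (fresh chw)) (trans eq old-u))) (bounded u))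
            (<-irrefl refl)
          ... | no ¬chw = uniq w cw (trans (sym (old ¬chw)) (trans eq old-u))

  -- Iterating rounds until every vertex is satisfied.

  module _ M .{{_ : NonZero M}} (reduce : ∀ U → Reduction M U) where

    -- While more than half of U is left, every step removes at least |U| / 2M vertices.
    iterate : ∀ t U → ∃[ U′ ]
      ((2 * count U′ ≤ count U ⊎ t * count U + 2 * M * count U′ ≤ 2 * M * count U)
       × (∀ m → Solution U′ m → Solution U (t + m)))
    iterate zero    U = U , inj₂ ≤-refl , λ m sol → sol
    iterate (suc t) U with iterate t U
    ... | U₁ , progress , lift₁ with reduce U₁
    ...   | U₂ , shrink , lift₂ = U₂ , progress′ progress ,
      λ m sol → subst (Solution U) (+-suc t m) (lift₁ (suc m) (lift₂ m sol))
      where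
      open ≤-Reasoning
      u = count U
      u₁ = count U₁
      u₂ = count U₂
      u₂≤u₁ : u₂ ≤ u₁
      u₂≤u₁ = *-cancelˡ-≤ M (≤-trans (m≤m+n _ u₁) shrink)
      lem : ∀ M t u u₁ u₂ → 2 * u₁ + t * u + 2 * M * u₂ ≡ t * u + 2 * (M * u₂ + u₁)
      lem = solve-∀
      progress′ : 2 * u₁ ≤ u ⊎ t * u + 2 * M * u₁ ≤ 2 * M * u →
        2 * u₂ ≤ u ⊎ suc t * u + 2 * M * u₂ ≤ 2 * M * u
      progress′ (inj₁ half) = inj₁ (≤-trans (*-monoʳ-≤ 2 u₂≤u₁) half)
      progress′ (inj₂ le) with 2 * u₁ ≤? u
      ... | yes half = inj₁ (≤-trans (*-monoʳ-≤ 2 u₂≤u₁) half)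
      ... | no ¬half = inj₂ (begin
        u + t * u + 2 * M * u₂         ≤⟨ +-monoˡ-≤ (2 * M * u₂) (+-monoˡ-≤ (t * u) (<⇒≤ (≰⇒> ¬half))) ⟩
        2 * u₁ + t * u + 2 * M * u₂    ≡⟨ lem M t u u₁ u₂ ⟩
        t * u + 2 * (M * u₂ + u₁)      ≤⟨ +-monoʳ-≤ (t * u) (*-monoʳ-≤ 2 shrink) ⟩
        t * u + 2 * (M * u₁)           ≡⟨ cong (t * u +_) (*-assoc 2 M u₁) ⟨
        t * u + 2 * M * u₁             ≤⟨ le ⟩
        2 * M * u                      ∎)

    -- After `M` rounds the accumulated loss is M * |U|/(2M) = |U|/2, so both alternatives of
    -- `iterate` leave at most half.
    halve : ∀ U → ∃[ U′ ] (2 * count U′ ≤ count U × (∀ m → Solution U′ m → Solution U (M + m)))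
    halve U with iterate M U
    ... | U′ , inj₁ half , lift = U′ , half , lift
    ... | U′ , inj₂ le , lift = U′ , *-cancelˡ-≤ M (+-cancelˡ-≤ (M * u) _ _ (begin
        M * u + M * (2 * u′)    ≡⟨ lem₁ M u u′ ⟩
        M * u + 2 * M * u′      ≤⟨ le ⟩
        2 * M * u               ≡⟨ lem₂ M u ⟩
        M * u + M * u           ∎)) , lift
      where
      open ≤-Reasoning
      u = count U
      u′ = count U′
      lem₁ : ∀ M u u′ → M * u + M * (2 * u′) ≡ M * u + 2 * M * u′
      lem₁ = solve-∀
      lem₂ : ∀ M u → 2 * M * u ≡ M * u + M * u
      lem₂ = solve-∀

    -- Each of `h` halvings costs `M` colours. The bound is strict so that at `h = 0` the set is
    -- empty and nothing needs colouring.
    solve : ∀ h U → count U < 2 ^ h → Solution U (h * M)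
    solve zero U (s≤s c≤0) = record
      { colour = λ _ → 0 ; bounded = λ _ → z≤n ; support = λ _ _ → refl
      ; unique = λ v Uv → contradiction (≤-trans (count-positive U v Uv) c≤0) λ () }
    solve (suc h) U c< with halve U
    ... | U′ , half , lift =
      lift (h * M) (solve h U′ (*-cancelˡ-< 2 _ _ (≤-<-trans half c<)))

  -- Here 0 becomes an ordinary colour, so `m + 1` colours must fit into `N`.
  Solution⇒χCN≤ : ∀ {m N} → m < N → Solution (λ _ → true) m → χCN≤ G N
  Solution⇒χCN≤ m<N sol = c , λ v →
      let u , cu , _ , uniq = unique v refl in
      c u , u , cu , refl , λ w cw eq → uniq w cw (fromℕ<-injective _ _ _ _ eq)
    where
    open Solution sol
    c : Fin n → Fin _
    c v = fromℕ< (≤-<-trans (bounded v) m<N)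

-- Bounding the number of colours by the two logarithms.

theorem4 : ∃[ C ] ((k n : ℕ) → 2 ≤ k → 2 ≤ n → (G : Graph n) → K1k-free k G →
    χCN≤ G (C * ⌈log₂ k ⌉ * ⌈log₂ n ⌉))
-- With a = `suc L` and b = `suc l`, the rounds use 8a(b + 1) ≤ 16ab colours, and colour 0 adds 1 ≤
-- ab.
theorem4 = 17 , main
  where
  main : (k n : ℕ) → 2 ≤ k → 2 ≤ n → (G : Graph n) → K1k-free k G →
    χCN≤ G (17 * ⌈log₂ k ⌉ * ⌈log₂ n ⌉)
  main k n 2≤k 2≤n G free
    with ⌈log₂ k ⌉ | ⌈log₂ n ⌉ | n≤2^⌈log₂n⌉ k | n≤2^⌈log₂n⌉ n
  ... | zero  | _     | k≤1  | _    = contradiction (≤-trans 2≤k k≤1) (<-irrefl refl)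
  ... | suc L | zero  | _    | n≤1  = contradiction (≤-trans 2≤n n≤1) (<-irrefl refl)
  ... | suc L | suc l | k≤2^ | n≤2^ = Solution⇒χCN≤ G enough
      -- One halving more than `suc l`: `n` may equal 2^(l+1), and `solve` wants a strict bound.
      (solve G (8 * suc L) (reduce G 2≤k free L k≤2^) (2 + l) (λ _ → true) (begin-strict
        count {n} (λ _ → true)  ≤⟨ count≤n {n} _ ⟩
        n                       ≤⟨ n≤2^ ⟩
        2 ^ suc l               <⟨ ^-monoʳ-< 2 (s≤s (s≤s z≤n)) (n<1+n (suc l)) ⟩
        2 ^ (2 + l)             ∎))
    where
    open ≤-Reasoning
    lem : ∀ L l → suc ((2 + l) * (8 * suc L)) + (L + 9 * l + 9 * (L * l)) ≡ 17 * suc L * suc l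
    lem = solve-∀
    enough : (2 + l) * (8 * suc L) < 17 * suc L * suc l
    enough = ≤-trans (m≤m+n _ (L + 9 * l + 9 * (L * l))) (≤-reflexive (lem L l))
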